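{- Let $n\in\mathbb{N}$, $\mathbf{y}=(y_1,y_2,\dots,y_n)\in\mathbb{N}^n$, and $\mathbf{y}^+=(y_1,\dots,y_n,y_{n+1})\in\mathbb{N}^{n+1}$. (a) If $(1^{n-d},\mathbf{w})\in\mathsf{PA}^{\mathrm{inv}}_n(\mathbf{y})$, where $\mathbf{w}\in\mathbb{N}_{>1}^d$, then $(1^{n-d+1},\mathbf{w}_{\widehat{i}})\in\mathsf{PA}^{\mathrm{inv}}_n(\mathbf{y})$ for all $i\in[d]$. (b) The image of $\deg:\mathsf{PA}^{\mathrm{inv}}_n(\mathbf{y})\to\{0,1,\dots,n-1\}$ is $\{0,1,\dots,\chi(\mathbf{y})\}$. In other words, for each $d\in\{0,1,\dots,\chi(\mathbf{y})\}$ there exists $\mathbf{x}\in\mathsf{PA}^{\mathrm{inv}}_n(\mathbf{y})$ with $\deg\mathbf{x}=d$. (c) If $\mathbf{x}\in\mathsf{PA}^{\mathrm{inv}}_n(\mathbf{y})$, then $(1,\mathbf{x})\in\mathsf{PA}^{\mathrm{inv}}_{n+1}(\mathbf{y}^+)$. In particular, $\mathbf{x}\mapsto(1,\mathbf{x})$ defines an injective map $\eta:\mathsf{PA}^{\mathrm{inv},\uparrow}_n(\mathbf{y})\hookrightarrow\mathsf{PA}^{\mathrm{inv},\uparrow}_{n+1}(\mathbf{y}^+)$. (d) If $\chi(\mathbf{y})=\alpha$, then $\chi(\mathbf{y}^+)\in\{\alpha,\alpha+1\}$.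
   Context: $\mathbb{N}=\{1,2,3,\dots\}$, $\mathbb{N}_{>1}=\{2,3,\dots\}$, and $[n]=\{1,\dots,n\}$. Let $\mathbf{y}=(y_1,\dots,y_n)\in\mathbb{N}^n$ and $m=\sum_{i=1}^n y_i$. Consider a one-way street with $m$ parking spots numbered $1,\dots,m$ and $n$ cars entering in order $1,2,\dots,n$, where car $i$ has length $y_i$ and prefers spot $x_i\in[m]$. Car $i$ drives to spot $x_i$ and parks in $x_i,x_i+1,\dots,x_i+y_i-1$ if these spots exist and are all unoccupied; otherwise it parks in the next $y_i$ contiguous available spots, i.e. it occupies $s,s+1,\dots,s+y_i-1$ for the smallest $s\ge x_i$ such that $s+y_i-1\le m$ and all these spots are unoccupied; if no such $s$ exists, parking fails. The vector $\mathbf{x}=(x_1,\dots,x_n)\in[m]^n$ is a parking assortment for $\mathbf{y}$ if all cars can park; the set of these is $\mathsf{PA}_n(\mathbf{y})$. A parking assortment $\mathbf{x}$ is (permutation) invariant if every permutation of its entries is also in $\mathsf{PA}_n(\mathbf{y})$; $\mathsf{PA}^{\mathrm{inv}}_n(\mathbf{y})$ is the set of invariant parking assortments for $\mathbf{y}$, and $\mathsf{PA}^{\mathrm{inv},\uparrow}_n(\mathbf{y})\subseteq\mathsf{PA}^{\mathrm{inv}}_n(\mathbf{y})$ is its subset of nondecreasing elements. For $\mathbf{x}\in\mathsf{PA}^{\mathrm{inv}}_n(\mathbf{y})$ the degree is $\deg\mathbf{x}=|\{i\in[n]:x_i\ne 1\}|$, and the characteristic of $\mathbf{y}$ is $\chi(\mathbf{y})=\max_{\mathbf{z}\in\mathsf{PA}^{\mathrm{inv}}_n(\mathbf{y})}\deg\mathbf{z}$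 (all of this applies to $\mathbf{y}^+$ with $n+1$ in place of $n$). List notation: for $\mathbf{v}=(v_1,\dots,v_d)$, $\mathbf{v}_{\widehat{i}}=(v_1,\dots,v_{i-1},v_{i+1},\dots,v_d)$ is $\mathbf{v}$ with the $i$th entry deleted; $(1^k,\mathbf{v})=(1,\dots,1,v_1,\dots,v_d)$ with $k$ leading ones; $(1,\mathbf{v})=(1^1,\mathbf{v})$. -}

module Defs where

open import Data.List.Base as List using (List; []; _∷_; upTo; cartesianProductWith)
open import Data.List.Extrema.Nat using (max)
open import Data.List.Membership.DecPropositional using () renaming (_∈?_ to mem?)
open import Data.List.Membership.Propositional using (_∈_; _∉_)
open import Data.List.Membership.Propositional.Properties
  using (∈-map⁺; ∈-upTo⁺; ∈-∃++; ∈-cartesianProductWith⁺)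
open import Data.List.Relation.Binary.Permutation.Propositional using (_↭_; ↭-refl; ↭-sym; ↭-trans; prep)
open import Data.List.Relation.Binary.Permutation.Propositional.Properties
  using (All-resp-↭; ∈-resp-↭; drop-∷; shift; ↭-empty-inv)
open import Data.List.Relation.Unary.All as ListAll using ()
open import Data.List.Relation.Unary.Any using (here; there)
open import Data.Nat.Base using (ℕ; zero; suc; _+_; _∸_; _≤_; _<_; s≤s)
open import Data.Nat.Properties
  using (_≟_; _≤?_; ≤-trans; m≤m+n; m∸n+n≡m; anyUpTo?; allUpTo?)
open import Data.Product.Base using (∃; _×_; _,_; proj₁; proj₂)
open import Data.Vec.Base using (Vec; []; _∷_; _++_; cast; count; replicate; sum; toList)
open import Data.Vec.Relation.Unary.All as All using (All; []; _∷_)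
open import Data.Vec.Relation.Unary.All.Properties using (toList⁺; toList⁻)
open import Data.Vec.Relation.Unary.Linked using (Linked)
open import Function.Base using (_∘_)
open import Level using (0ℓ)
open import Relation.Binary.Bundles using (Setoid)
import Relation.Binary.Construct.On as On
open import Relation.Binary.PropositionalEquality using (_≡_; refl; setoid)
open import Relation.Nullary using (¬_; Dec; yes; no; contradiction)
open import Relation.Nullary.Decidable using (map′; _×-dec_; _→-dec_; ¬?)

private
  variable
    n d : ℕ

-- A street is given by its number m of spots, numbered 1, …, m, together with
-- the list of the spots that are already occupied.

block : (s ℓ : ℕ) → List ℕ
block s ℓ = List.map (s +_) (upTo ℓ)

-- s + ℓ ≤ suc m is s + ℓ - 1 ≤ m without truncated subtraction.
Fits : (m : ℕ) (occupied : List ℕ) (ℓ s : ℕ) → Set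
Fits m occupied ℓ s = s + ℓ ≤ suc m × ListAll.All (_∉ occupied) (block s ℓ)

-- Parking at the preferred spot x itself is the case s ≡ x.
ParksAt : (m : ℕ) (occupied : List ℕ) (ℓ x s : ℕ) → Set
ParksAt m occupied ℓ x s =
  x ≤ s × Fits m occupied ℓ s × (∀ {t} → t < s → x ≤ t → ¬ Fits m occupied ℓ t)

data AllPark (m : ℕ) (occupied : List ℕ) : Vec ℕ n → Vec ℕ n → Set where
  []  : AllPark m occupied [] []
  _∷_ : ∀ {ℓ x s} {ys xs : Vec ℕ n} →
        ParksAt m occupied ℓ x s →
        AllPark m (block s ℓ List.++ occupied) ys xs →
        AllPark m occupied (ℓ ∷ ys) (x ∷ xs)

Spot : (m s : ℕ) → Set
Spot m s = 1 ≤ s × s ≤ m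

PA : Vec ℕ n → Vec ℕ n → Set
PA y x = All (Spot (sum y)) x × AllPark (sum y) [] y x

PAinv : Vec ℕ n → Vec ℕ n → Set
PAinv {n} y x = PA y x × (∀ (z : Vec ℕ n) → toList z ↭ toList x → PA y z)

PAinv↑ : Vec ℕ n → Vec ℕ n → Set
PAinv↑ y x = PAinv y x × Linked _≤_ x

-- The set of nondecreasing invariant parking assortments: two elements are
-- equal when the underlying vectors are, whatever the membership proofs.
PAinv↑-setoid : Vec ℕ n → Setoid 0ℓ 0ℓ
PAinv↑-setoid {n} y = On.setoid {B = ∃ (PAinv↑ y)} (setoid (Vec ℕ n)) proj₁

deg : Vec ℕ n → ℕ
deg = count (λ s → ¬? (s ≟ 1))

-- (1ⁿ⁻ᵈ , w)
pad : d ≤ n → Vec ℕ d → Vec ℕ n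
pad {d} {n} d≤n w = cast (m∸n+n≡m d≤n) (replicate (n ∸ d) 1 ++ w)

-- Membership in PAinv is decidable, so that χ can be defined as the maximum of
-- an explicit finite list.

fits? : ∀ m occupied ℓ s → Dec (Fits m occupied ℓ s)
fits? m occupied ℓ s =
  (s + ℓ ≤? suc m) ×-dec ListAll.all? (λ t → ¬? (mem? _≟_ t occupied)) (block s ℓ)

parksAt? : ∀ m occupied ℓ x s → Dec (ParksAt m occupied ℓ x s)
parksAt? m occupied ℓ x s =
  (x ≤? s) ×-dec fits? m occupied ℓ s ×-dec
  allUpTo? (λ t → (x ≤? t) →-dec ¬? (fits? m occupied ℓ t)) s

allPark? : ∀ m occupied (y x : Vec ℕ n) → Dec (AllPark m occupied y x)
allPark? m occupied []       []       = yes []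
allPark? m occupied (ℓ ∷ ys) (x ∷ xs) =
  map′ (λ { (_ , _ , p , ps) → p ∷ ps })
       (λ { (p@(_ , (s+ℓ≤1+m , _) , _) ∷ ps) →
            _ , s≤s (≤-trans (m≤m+n _ ℓ) s+ℓ≤1+m) , p , ps })
       (anyUpTo? (λ s → parksAt? m occupied ℓ x s ×-dec
                        allPark? m (block s ℓ List.++ occupied) ys xs)
                 (suc (suc m)))

pa? : (y x : Vec ℕ n) → Dec (PA y x)
pa? y x = All.all? (λ s → (1 ≤? s) ×-dec (s ≤? sum y)) x ×-dec allPark? (sum y) [] y x

_↭?_ : (xs ys : List ℕ) → Dec (xs ↭ ys)
[] ↭? []       = yes ↭-refl
[] ↭? (_ ∷ _)  = no λ p → contradiction (↭-empty-inv (↭-sym p)) λ ()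
(x ∷ xs) ↭? ys with mem? _≟_ x ys
... | no x∉ys = no λ p → x∉ys (∈-resp-↭ p (here refl))
... | yes x∈ys with ∈-∃++ x∈ys
...   | as , bs , refl =
  map′ (λ p → ↭-trans (prep x p) (↭-sym (shift x as bs)))
       (λ p → drop-∷ (↭-trans p (shift x as bs)))
       (xs ↭? (as List.++ bs))

-- All elements of [m]ⁿ.
preferences : (m n : ℕ) → List (Vec ℕ n)
preferences m zero    = [] ∷ []
preferences m (suc n) =
  cartesianProductWith _∷_ (List.map suc (upTo m)) (preferences m n)

∈-preferences : ∀ {m} {x : Vec ℕ n} → All (Spot m) x → x ∈ preferences m n
∈-preferences []                      = here refl
∈-preferences ((s≤s _ , s≤m) ∷ spots) =
  ∈-cartesianProductWith⁺ _∷_ (∈-map⁺ suc (∈-upTo⁺ s≤m)) (∈-preferences spots)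

paInv? : (y x : Vec ℕ n) → Dec (PAinv y x)
paInv? {n} y x with pa? y x
... | no ¬pa = no (¬pa ∘ proj₁)
... | yes pa@(spots , _) =
  map′ (λ all → pa , λ z z↭x →
          ListAll.lookup all
            (∈-preferences (toList⁻ (All-resp-↭ (↭-sym z↭x) (toList⁺ spots)))) z↭x)
       (λ inv → ListAll.tabulate λ {z} _ → proj₂ inv z)
       (ListAll.all? (λ z → (toList z ↭? toList x) →-dec pa? y z) (preferences (sum y) n))

-- The bottom value 0 supplied to max is harmless: it is the degree of (1, …, 1),
-- which is always an invariant parking assortment.
χ : Vec ℕ n → ℕ
χ {n} y = max 0 (List.map deg (List.filter (paInv? y) (preferences (sum y) n)))

{-# OPTIONS --safe #-}

-- Everything rests on lowering: in an invariant list of preferences, replacing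
-- an entry v by a number c below all free spots, such as 1, keeps the list
-- invariant. Since all spots get occupied, the least entry q is itself below all
-- free spots, so a first car that prefers c parks as if it preferred q; if q is
-- not the entry v, then by induction v may be lowered to q in what remains.
-- For (c), a last car that prefers a ≠ 1 leaves to the others x with a lowered
-- to 1. For (d), if the last car has a greatest preference, then the other cars
-- park in front of it, so deleting that preference gives an invariant
-- assortment for y.
module Submission where

open import Defs
open import Data.Bool.Base using (true; false)
open import Data.Fin.Base using (Fin; zero; suc)
open import Data.List.Base as List using (List; []; _∷_; length; upTo; filter)
open import Data.List.Extrema.Nat
  using (max; min; argmin-sel; argmax-sel; argmax-all; min≤⊤; min≤xs; ⊥≤max; xs≤max)
open import Data.List.Membership.DecPropositional using () renaming (_∈?_ to mem?)
open import Data.List.Membership.Propositional using (_∈_; _∉_; find)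
open import Data.List.Membership.Propositional.Properties
  using (∈-∃++; ∈-map⁺; ∈-map⁻; ∈-upTo⁺; ∈-upTo⁻; ∈-filter⁺; ∈-filter⁻; ∈-++⁺ˡ; ∈-++⁺ʳ; ∈-++⁻)
open import Data.List.Properties
  using (length-++; length-map; length-upTo; length-filter; filter-accept)
open import Data.List.Relation.Binary.Permutation.Propositional
  using (_↭_; ↭-refl; ↭-reflexive; ↭-sym; ↭-trans; prep; swap)
open import Data.List.Relation.Binary.Permutation.Propositional.Properties
  using (All-resp-↭; ∈-resp-↭; drop-∷; shift; ++⁺ˡ; ↭-length; filter-↭; ∷↭∷ʳ)
open import Data.List.Relation.Unary.All as ListAll using ([]; _∷_)
import Data.List.Relation.Unary.All.Properties as ListAll
open import Data.List.Relation.Unary.AllPairs using ([]; _∷_)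
open import Data.List.Relation.Unary.Any using (Any; here; there)
open import Data.List.Relation.Unary.Unique.Propositional using (Unique)
import Data.List.Relation.Unary.Unique.Propositional.Properties as Unique
open import Data.Nat.Base
  using (ℕ; zero; suc; _+_; _∸_; _≤_; _<_; z≤n; s≤s; NonZero)
open import Data.Nat.Properties
open import Data.Product.Base using (∃; ∃₂; Σ-syntax; _×_; _,_; proj₁; proj₂)
open import Data.Sum.Base using (_⊎_; inj₁; inj₂; [_,_]′)
open import Data.Vec.Base as Vec
  using (Vec; []; _∷_; _∷ʳ_; initLast; lookup; removeAt; replicate; sum; toList)
open import Data.Vec.Properties using (length-toList; toList-∷ʳ; toList-cast; toList-++; ∷-injectiveʳ)
open import Data.Vec.Relation.Unary.All as All using (All; []; _∷_)
open import Data.Vec.Relation.Unary.All.Properties using (toList⁺; toList⁻)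
open import Data.Vec.Relation.Unary.Linked using (Linked; []; [-]; _∷_)
open import Function.Base using (_∘_)
open import Function.Bundles using (_⇔_; mk⇔; Injection)
open import Relation.Binary.Definitions using (tri<; tri≈; tri>)
open import Relation.Binary.PropositionalEquality
  using (_≡_; refl; sym; trans; cong; subst; module ≡-Reasoning)
open import Relation.Nullary using (does; yes; no; contradiction)
open import Relation.Nullary.Decidable using (¬?)

private
  variable
    n m k ℓ x s v c q f : ℕ
    T xs occ : List ℕ

-- Lists up to permutation, and blocks of spots

∈⇒↭ : {x : ℕ} {ys : List ℕ} → x ∈ ys → ∃ λ R → ys ↭ x ∷ R
∈⇒↭ x∈ys with as , bs , refl ← ∈-∃++ x∈ys = as List.++ bs , shift _ as bs

-- The pigeonhole principle, by removing each element of `xs` from `ys` in turn.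
unique-⊆-length : {xs ys : List ℕ} → Unique xs → (∀ {z} → z ∈ xs → z ∈ ys) → length xs ≤ length ys
unique-⊆-length []               _     = z≤n
unique-⊆-length (x∉xs ∷ unique) xs⊆ys with R , ys↭ ← ∈⇒↭ (xs⊆ys (here refl)) =
  ≤-trans (s≤s (unique-⊆-length unique xs⊆R)) (≤-reflexive (sym (↭-length ys↭)))
  where
  xs⊆R : ∀ {z} → z ∈ _ → z ∈ R
  xs⊆R z∈xs with ∈-resp-↭ ys↭ (xs⊆ys (there z∈xs))
  ... | here refl  = contradiction refl (ListAll.lookup x∉xs z∈xs)
  ... | there z∈R = z∈R

vecOf : (xs : List ℕ) → length xs ≡ n → ∃ λ (z : Vec ℕ n) → toList z ≡ xs
vecOf []       refl = [] , refl
vecOf (x ∷ xs) refl with z , eq ← vecOf xs refl = x ∷ z , cong (x ∷_) eq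

∈-block⁺ : f < s + ℓ → s ≤ f → f ∈ block s ℓ
∈-block⁺ {f} {s} f<s+ℓ s≤f =
  subst (_∈ _) (m+[n∸m]≡n s≤f)
    (∈-map⁺ (s +_) (∈-upTo⁺ (+-cancelˡ-< s _ _ (subst (_< _) (sym (m+[n∸m]≡n s≤f)) f<s+ℓ))))

∈-block⁻ : f ∈ block s ℓ → s ≤ f × f < s + ℓ
∈-block⁻ {s = s} f∈ with i , i∈ , refl ← ∈-map⁻ (s +_) f∈ = m≤m+n s i , +-monoʳ-< s (∈-upTo⁻ i∈)

-- Streets and their free spots

-- m spots, of which those in occ are occupied and k are free.
record Street (m : ℕ) (occ : List ℕ) (k : ℕ) : Set where
  field
    unique : Unique occ
    spots  : ListAll.All (Spot m) occ
    size   : length occ + k ≡ m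

empty : Street m [] m
empty = record { unique = [] ; spots = [] ; size = refl }

-- A free `f` would make `f ∷ occ` a list of `m + 1` distinct spots out of `m`.
full : Street m occ 0 → Spot m f → f ∈ occ
full {m} {occ} {suc f} street (_ , f≤m) with mem? _≟_ (suc f) occ
... | yes f∈ = f∈
... | no f∉  = contradiction
  (≤-trans (unique-⊆-length (ListAll.¬Any⇒All¬ _ f∉ ∷ Street.unique street) ⊆spots)
    (≤-reflexive (trans (length-map suc (upTo m)) (length-upTo m))))
  (≤⇒≯ (≤-reflexive (trans (sym (Street.size street)) (+-identityʳ _))))
  where
  ⊆spots : ∀ {z} → z ∈ suc f ∷ occ → z ∈ List.map suc (upTo m)
  ⊆spots (here refl) = ∈-map⁺ suc (∈-upTo⁺ f≤m)
  ⊆spots {zero}  (there z∈) = contradiction (proj₁ (ListAll.lookup (Street.spots street) z∈)) λ ()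
  ⊆spots {suc z} (there z∈) = ∈-map⁺ suc (∈-upTo⁺ (proj₂ (ListAll.lookup (Street.spots street) z∈)))

park : 1 ≤ x → ParksAt m occ ℓ x s → Street m occ (ℓ + k) → Street m (block s ℓ List.++ occ) k
park {m = m} {occ} {ℓ} {s} {k} 1≤x (x≤s , (s+ℓ≤1+m , free) , _) street = record
  { unique = Unique.++⁺ (Unique.map⁺ (+-cancelˡ-≡ s _ _) (Unique.upTo⁺ ℓ)) (Street.unique street)
               λ { (z∈block , z∈occ) → ListAll.lookup free z∈block z∈occ }
  ; spots  = ListAll.++⁺ (ListAll.tabulate inside) (Street.spots street)
  ; size   = begin
      length (block s ℓ List.++ occ) + k       ≡⟨ cong (_+ k) (length-++ (block s ℓ)) ⟩
      length (block s ℓ) + length occ + k      ≡⟨ cong (λ b → b + length occ + k) (trans (length-map (s +_) (upTo ℓ)) (length-upTo ℓ)) ⟩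
      ℓ + length occ + k                       ≡⟨ cong (_+ k) (+-comm ℓ (length occ)) ⟩
      length occ + ℓ + k                       ≡⟨ +-assoc (length occ) ℓ k ⟩
      length occ + (ℓ + k)                     ≡⟨ Street.size street ⟩
      m                                        ∎
  }
  where
  open ≡-Reasoning
  inside : ∀ {z} → z ∈ block s ℓ → Spot m z
  inside z∈ with s≤z , z<s+ℓ ← ∈-block⁻ z∈ =
    ≤-trans 1≤x (≤-trans x≤s s≤z) , ≤-pred (≤-trans z<s+ℓ s+ℓ≤1+m)

parksAt-unique : ∀ {s′} → ParksAt m occ ℓ x s → ParksAt m occ ℓ x s′ → s ≡ s′
parksAt-unique {s = s} {s′} (x≤s , fits , least) (x≤s′ , fits′ , least′) with <-cmp s s′
... | tri< s<s′ _ _ = contradiction fits (least′ s<s′ x≤s)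
... | tri≈ _ refl _ = refl
... | tri> _ _ s′<s = contradiction fits′ (least s′<s x≤s′)

fits⇒free : 0 < ℓ → 1 ≤ s → Fits m occ ℓ s → Spot m s × s ∉ occ
fits⇒free {ℓ} {s} 0<ℓ 1≤s (s+ℓ≤1+m , free) =
  (1≤s , ≤-pred (≤-trans s<s+ℓ s+ℓ≤1+m)) , ListAll.lookup free (∈-block⁺ s<s+ℓ ≤-refl)
  where
  s<s+ℓ : s < s + ℓ
  s<s+ℓ = m<m+n s 0<ℓ

-- Preferences below all free spots

BelowFree : (m : ℕ) (occ : List ℕ) (c : ℕ) → Set
BelowFree m occ c = 1 ≤ c × (∀ {f} → Spot m f → f ∉ occ → c ≤ f)

belowFree-++ : ∀ block → BelowFree m occ c → BelowFree m (block List.++ occ) c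
belowFree-++ block (1≤c , below) = 1≤c , λ spot f∉ → below spot (f∉ ∘ ∈-++⁺ʳ block)

-- Since `0 < ℓ`, wherever the car fits, its first spot is free and so lies at or beyond both `c`
-- and `q`: the two searches meet the same candidates.
belowFree-exchange : 0 < ℓ → BelowFree m occ c → BelowFree m occ q →
                     ParksAt m occ ℓ c s → ParksAt m occ ℓ q s
belowFree-exchange 0<ℓ (1≤c , c-below) (1≤q , q-below) (c≤s , fits , least) =
  q≤s , fits , λ t<s q≤t fits-t → least t<s (c≤ q≤t fits-t) fits-t
  where
  q≤s = let spot , free = fits⇒free 0<ℓ (≤-trans 1≤c c≤s) fits in q-below spot free
  c≤ : ∀ {t} → _ ≤ t → Fits _ _ _ t → _ ≤ t
  c≤ q≤t fits-t = let spot , free = fits⇒free 0<ℓ (≤-trans 1≤q q≤t) fits-t in c-below spot free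

-- All spots end up occupied, so whoever occupies f must prefer a spot up to f.
covering-preference : {ys xs : Vec ℕ n} → AllPark m occ ys xs → Street m occ (sum ys) →
                      All (1 ≤_) xs → Spot m f → f ∉ occ → Any (_≤ f) (toList xs)
covering-preference [] street _ spot f∉ = contradiction (full street spot) f∉
covering-preference {f = f} {xs = x ∷ _} (p@(x≤s , _) ∷ ps) street (1≤x ∷ 1≤xs) spot f∉ with x ≤? f
... | yes x≤f = here x≤f
... | no x≰f  = there (covering-preference ps (park 1≤x p street) 1≤xs spot
  λ f∈ → [ (λ f∈block → x≰f (≤-trans x≤s (proj₁ (∈-block⁻ f∈block)))) , f∉ ]′ (∈-++⁻ (block _ _) f∈))

-- The witness is the minimum: every free spot has some preference at or below it, hence also the
-- least one.
belowFree-member : {ys xs : Vec ℕ n} → AllPark m occ ys xs → Street m occ (sum ys) →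
                   toList xs ↭ v ∷ T → ListAll.All (1 ≤_) (v ∷ T) →
                   ∃ λ q → q ∈ v ∷ T × BelowFree m occ q
belowFree-member {v = v} {T = T} parks street xs↭ 1≤ = min v T , min∈ , ListAll.lookup 1≤ min∈ , below
  where
  min∈ : min v T ∈ v ∷ T
  min∈ with argmin-sel (λ z → z) v T
  ... | inj₁ eq  = here eq
  ... | inj₂ ∈T = there ∈T
  below : ∀ {f} → Spot _ f → f ∉ _ → min v T ≤ f
  below spot f∉
    with r , r∈ , r≤f ← find (covering-preference parks street (toList⁻ (All-resp-↭ (↭-sym xs↭) 1≤)) spot f∉) =
    ≤-trans (ListAll.lookup (min≤⊤ v T ∷ min≤xs v T) (∈-resp-↭ xs↭ r∈)) r≤f

-- Lowering an entry

-- The preferences are a list up to permutation, so that any entry can be brought to the front;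
-- `occ` is arbitrary to allow induction along the cars.
Inv : (m : ℕ) (occ : List ℕ) (y : Vec ℕ n) (T : List ℕ) → Set
Inv {n} m occ y T = ∀ (z : Vec ℕ n) → toList z ↭ T → AllPark m occ y z

Inv-resp-↭ : ∀ {T T′} {y : Vec ℕ n} → T ↭ T′ → Inv m occ y T → Inv m occ y T′
Inv-resp-↭ T↭T′ inv z z↭ = inv z (↭-trans z↭ (↭-sym T↭T′))

-- Where the first car parks depends only on its own preference, so one `s` serves all arrangements
-- of the others.
Inv-uncons : {ys : Vec ℕ n} → length T ≡ n → Inv m occ (ℓ ∷ ys) (x ∷ T) →
             ∃ λ s → ParksAt m occ ℓ x s × Inv m (block s ℓ List.++ occ) ys T
Inv-uncons {T = T} {x = x} len inv with w , refl ← vecOf T len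
  with _∷_ {s = s} p _ ← inv (x ∷ w) ↭-refl = s , p , tails
  where
  tails : Inv _ _ _ _
  tails z z↭ with p′ ∷ ps ← inv (x ∷ z) (prep x z↭) with refl ← parksAt-unique p p′ = ps

-- Induction on the cars. The new value is any `c` below the free spots, not just 1, because a
-- recursive call may have to lower `v` to `q`.
Inv-lower : {ys : Vec ℕ n} → All (0 <_) ys → Street m occ (sum ys) →
            ListAll.All (1 ≤_) (v ∷ T) → BelowFree m occ c →
            Inv m occ ys (v ∷ T) → Inv m occ ys (c ∷ T)
Inv-lower [] _ _ _ _ [] _ = []
Inv-lower {v = v} {T = T} {c = c} (0<ℓ ∷ 0<ys) street 1≤@(1≤v ∷ 1≤T) below inv (p ∷ z) z↭
  with ∈-resp-↭ z↭ (here refl)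
... | here refl = case-q (belowFree-member (inv (v ∷ z) vz↭) street vz↭ 1≤)
  where
  z↭T : toList z ↭ T
  z↭T = drop-∷ z↭
  vz↭ : toList (v ∷ z) ↭ v ∷ T
  vz↭ = prep v z↭T
  case-q : (∃ λ q → q ∈ v ∷ T × BelowFree _ _ q) → AllPark _ _ _ (c ∷ z)
  case-q (q , here refl , q-below) with par ∷ pars ← inv (v ∷ z) vz↭ =
    belowFree-exchange 0<ℓ q-below below par ∷ pars
  -- A first car preferring `q` parks where one preferring `c` does. As `z` arranges `q ∷ T′`, it
  -- remains to lower `v` to `q` among the later cars.
  case-q (q , there q∈T , q-below@(1≤q , _)) with T′ , T↭ ← ∈⇒↭ q∈T
    with s , par , inv′ ← Inv-uncons {T = v ∷ T′} {x = q}
           (trans (sym (↭-length T↭)) (trans (sym (↭-length z↭T)) (length-toList z)))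
           (Inv-resp-↭ (↭-trans (prep v T↭) (swap v q ↭-refl)) inv) =
    belowFree-exchange 0<ℓ q-below below par
    ∷ Inv-lower 0<ys (park 1≤q par street) (1≤v ∷ ListAll.tail (All-resp-↭ T↭ 1≤T))
        (belowFree-++ (block s _) q-below) inv′ z (↭-trans z↭T T↭)
-- The first car prefers some `p` from `T`; it parks the same way before and after the lowering,
-- which is left to the later cars.
... | there p∈T with T′ , T↭ ← ∈⇒↭ p∈T
  with z↭′ ← drop-∷ (↭-trans z↭ (↭-trans (prep c T↭) (swap c p ↭-refl)))
  with s , par , inv′ ← Inv-uncons {T = v ∷ T′} {x = p}
         (trans (sym (↭-length z↭′)) (length-toList z))
         (Inv-resp-↭ (↭-trans (prep v T↭) (swap v p ↭-refl)) inv) =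
  par ∷ Inv-lower 0<ys (park (ListAll.head 1≤pT′) par street) (1≤v ∷ ListAll.tail 1≤pT′)
          (belowFree-++ (block s _) below) inv′ z z↭′
  where
  1≤pT′ : ListAll.All (1 ≤_) (p ∷ T′)
  1≤pT′ = All-resp-↭ T↭ 1≤T

-- Lowering in invariant parking assortments

PAinv⇒Inv : {y x : Vec ℕ n} → PAinv y x → Inv (sum y) [] y (toList x)
PAinv⇒Inv (_ , perm) z z↭ = proj₂ (perm z z↭)

Inv⇒PAinv : {y x : Vec ℕ n} → ListAll.All (Spot (sum y)) (toList x) →
            Inv (sum y) [] y (toList x) → PAinv y x
Inv⇒PAinv {x = x} spots inv =
  (toList⁻ spots , inv x ↭-refl) , λ z z↭ → toList⁻ (All-resp-↭ (↭-sym z↭) spots) , inv z z↭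

PAinv-spots : {y x : Vec ℕ n} → PAinv y x → ListAll.All (Spot (sum y)) (toList x)
PAinv-spots ((spots , _) , _) = toList⁺ spots

PAinv-lower : {y x x′ : Vec ℕ n} → All (0 <_) y → PAinv y x →
              toList x ↭ v ∷ T → toList x′ ↭ 1 ∷ T → PAinv y x′
PAinv-lower {v = v} {T = T} {y = y} 0<y inv x↭ x′↭ =
  Inv⇒PAinv
    (All-resp-↭ (↭-sym x′↭) ((≤-refl , ≤-trans (proj₁ v-spot) (proj₂ v-spot)) ∷ ListAll.tail spots))
    (Inv-resp-↭ (↭-sym x′↭)
      (Inv-lower 0<y empty (ListAll.map proj₁ spots) (≤-refl , λ spot _ → proj₁ spot)
        (Inv-resp-↭ x↭ (PAinv⇒Inv inv))))
  where
  spots : ListAll.All (Spot (sum y)) (v ∷ T)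
  spots = All-resp-↭ x↭ (PAinv-spots inv)
  v-spot : Spot (sum y) v
  v-spot = ListAll.head spots

-- Appending a last car

toList-∷ʳ-↭ : (u : Vec ℕ n) (a : ℕ) → toList (u ∷ʳ a) ↭ a ∷ toList u
toList-∷ʳ-↭ u a = ↭-trans (↭-reflexive (toList-∷ʳ a u)) (↭-sym (∷↭∷ʳ a (toList u)))

sum-∷ʳ : (y : Vec ℕ n) (ℓ : ℕ) → sum (y ∷ʳ ℓ) ≡ sum y + ℓ
sum-∷ʳ []       ℓ = +-identityʳ ℓ
sum-∷ʳ (k ∷ y) ℓ = trans (cong (k +_) (sum-∷ʳ y ℓ)) (sym (+-assoc k (sum y) ℓ))

-- Minimality concerns only starts before `s`; their blocks end before that of `s` does, hence
-- within the first `m` spots.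
parksAt-widen : ∀ {m′} → m ≤ m′ → ParksAt m occ ℓ x s → ParksAt m′ occ ℓ x s
parksAt-widen m≤m′ (x≤s , (s+ℓ≤1+m , free) , least) =
  x≤s , (≤-trans s+ℓ≤1+m (s≤s m≤m′) , free) ,
  λ t<s x≤t (_ , free-t) →
    least t<s x≤t (≤-trans (+-monoˡ-≤ _ (<⇒≤ t<s)) s+ℓ≤1+m , free-t)

-- The earlier cars fill the `m` spots exactly, so the last car has to start at `suc m`.
AllPark-∷ʳ⁺ : ∀ {ys xs : Vec ℕ n} {a} → 0 < ℓ → 1 ≤ a → a ≤ suc m →
              Street m occ (sum ys) → All (1 ≤_) xs →
              AllPark m occ ys xs → AllPark (m + ℓ) occ (ys ∷ʳ ℓ) (xs ∷ʳ a)
AllPark-∷ʳ⁺ {ℓ = ℓ} {m = m} 0<ℓ 1≤a a≤1+m street [] [] =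
  (a≤1+m , (≤-refl , ListAll.tabulate free) ,
   λ t<1+m a≤t fits →
     proj₂ (fits⇒free 0<ℓ (≤-trans 1≤a a≤t) fits) (full street (≤-trans 1≤a a≤t , ≤-pred t<1+m)))
  ∷ []
  where
  free : ∀ {z} → z ∈ block (suc m) ℓ → z ∉ _
  free z∈block z∈occ = <⇒≱ (proj₁ (∈-block⁻ z∈block)) (proj₂ (ListAll.lookup (Street.spots street) z∈occ))
AllPark-∷ʳ⁺ 0<ℓ 1≤a a≤1+m street (1≤x ∷ 1≤xs) (p ∷ ps) =
  parksAt-widen (m≤m+n _ _) p ∷ AllPark-∷ʳ⁺ 0<ℓ 1≤a a≤1+m (park 1≤x p street) 1≤xs ps

PAinv-1∷ : {y x : Vec ℕ n} → All (0 <_) y → 0 < ℓ → PAinv y x → PAinv (y ∷ʳ ℓ) (1 ∷ x)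
PAinv-1∷ {ℓ = ℓ} {y = y} {x = x} 0<y 0<ℓ inv =
  subst (λ m → ListAll.All (Spot m) (1 ∷ toList x) → Inv m [] (y ∷ʳ ℓ) (1 ∷ toList x) →
               PAinv (y ∷ʳ ℓ) (1 ∷ x))
    (sum-∷ʳ y ℓ) Inv⇒PAinv spots parks
  where
  spots : ListAll.All (Spot (sum y + ℓ)) (1 ∷ toList x)
  spots = (≤-refl , ≤-trans 0<ℓ (m≤n+m ℓ (sum y)))
        ∷ ListAll.map (λ (1≤s , s≤m) → 1≤s , ≤-trans s≤m (m≤m+n _ ℓ)) (PAinv-spots inv)
  -- The bound is `suc (sum y)` rather than `sum y` so that 1 satisfies it even when `y` is empty.
  preferences≤ : ListAll.All (_≤ suc (sum y)) (1 ∷ toList x)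
  preferences≤ = s≤s z≤n ∷ ListAll.map (m≤n⇒m≤1+n ∘ proj₂) (PAinv-spots inv)
  parks : Inv (sum y + ℓ) [] (y ∷ʳ ℓ) (1 ∷ toList x)
  parks z z↭ with u , a , refl ← initLast z =
    AllPark-∷ʳ⁺ 0<ℓ (proj₁ (ListAll.lookup spots a∈)) (ListAll.lookup preferences≤ a∈)
      empty (All.map proj₁ (proj₁ (proj₁ u-inv))) (proj₂ (proj₁ u-inv))
    where
    au↭ : a ∷ toList u ↭ 1 ∷ toList x
    au↭ = ↭-trans (↭-sym (toList-∷ʳ-↭ u a)) z↭
    a∈ : a ∈ 1 ∷ toList x
    a∈ = ∈-resp-↭ au↭ (here refl)
    u-inv : PAinv y u
    u-inv with a∈
    ... | here refl = Inv⇒PAinv (All-resp-↭ (↭-sym u↭) (PAinv-spots inv))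
                                (Inv-resp-↭ (↭-sym u↭) (PAinv⇒Inv inv))
      where u↭ = drop-∷ au↭
    ... | there a∈x with R , x↭ ← ∈⇒↭ a∈x =
      PAinv-lower 0<y inv x↭ (drop-∷ (↭-trans au↭ (↭-trans (prep 1 x↭) (swap 1 a ↭-refl))))

-- Removing a last car with a greatest preference

parksAt-narrow : ∀ {m′} → m ≤ m′ → s + ℓ ≤ suc m → ParksAt m′ occ ℓ x s → ParksAt m occ ℓ x s
parksAt-narrow m≤m′ s+ℓ≤1+m (x≤s , (_ , free) , least) =
  x≤s , (s+ℓ≤1+m , free) ,
  λ t<s x≤t (t+ℓ≤1+m , free-t) → least t<s x≤t (≤-trans t+ℓ≤1+m (s≤s m≤m′) , free-t)

-- The last car starts at some h ≥ b. Were an earlier car to park beyond h, the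
-- first one to do so could have started at h.
AllPark-∷ʳ⁻ : ∀ {ys xs : Vec ℕ n} {b} → 0 < ℓ → AllPark (m + ℓ) occ (ys ∷ʳ ℓ) (xs ∷ʳ b) →
              All (_≤ b) xs →
              ∃ λ h → b ≤ h × h ≤ suc m × h ∉ occ ×
                      (ListAll.All (_< h) occ → AllPark m occ ys xs)
AllPark-∷ʳ⁻ {ys = []} {[]} 0<ℓ (_∷_ {s = h} (b≤h , (h+ℓ≤ , free) , _) []) [] =
  h , b≤h , +-cancelʳ-≤ _ h _ h+ℓ≤ , ListAll.lookup free (∈-block⁺ (m<m+n h 0<ℓ) ≤-refl) , λ _ → []
AllPark-∷ʳ⁻ {m = m} {occ = occ} {ys = k ∷ ys} {x ∷ xs} 0<ℓ
  (_∷_ {s = s} p@(x≤s , (s+k≤ , _) , least) ps) (x≤b ∷ xs≤b)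
  with h , b≤h , h≤1+m , h∉ , earlier ← AllPark-∷ʳ⁻ 0<ℓ ps xs≤b =
  -- `h` is known only from the later cars, so the condition that occupied spots lie in front of it
  -- enters as an implication.
  h , b≤h , h≤1+m , h∉ ∘ ∈-++⁺ʳ (block s k) , λ occ<h →
    parksAt-narrow (m≤m+n m _) (≤-trans (s+k≤h occ<h) h≤1+m) p
    ∷ earlier (ListAll.++⁺ (ListAll.tabulate λ z∈ → <-≤-trans (proj₂ (∈-block⁻ z∈)) (s+k≤h occ<h)) occ<h)
  where
  s+k≤h : ListAll.All (_< h) occ → s + k ≤ h
  s+k≤h occ<h with s ≤? h
  ... | yes s≤h = ≮⇒≥ λ h<s+k → h∉ (∈-++⁺ˡ (∈-block⁺ h<s+k s≤h))
  ... | no s≰h  = contradiction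
    (≤-trans (+-monoˡ-≤ k (<⇒≤ (≰⇒> s≰h))) s+k≤ ,
     ListAll.tabulate λ z∈block z∈occ → <⇒≱ (ListAll.lookup occ<h z∈occ) (proj₁ (∈-block⁻ z∈block)))
    (least (≰⇒> s≰h) (≤-trans x≤b b≤h))

-- Recovers the bound on preferences for the shorter street, where the assortment on the longer one
-- only gives a weaker bound.
AllPark-preferences≤ : ∀ {ys xs : Vec ℕ n} → All (0 <_) ys → AllPark m occ ys xs → All (_≤ m) xs
AllPark-preferences≤ [] [] = []
AllPark-preferences≤ (0<k ∷ 0<ys) ((x≤s , (s+k≤1+m , _) , _) ∷ ps) =
  ≤-pred (≤-trans (s≤s x≤s) (≤-trans (m<m+n _ 0<k) s+k≤1+m)) ∷ AllPark-preferences≤ 0<ys ps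

max-∈ : ∀ a xs → max a xs ∈ a ∷ xs
max-∈ a xs with argmax-sel (λ k → k) a xs
... | inj₁ eq  = here eq
... | inj₂ ∈xs = there ∈xs

∃-max : (z : Vec ℕ (suc n)) → ∃₂ λ b (x : Vec ℕ n) → toList z ↭ b ∷ toList x × ListAll.All (_≤ b) (toList x)
∃-max (a ∷ t) with R , z↭ ← ∈⇒↭ (max-∈ a (toList t))
  with x , refl ← vecOf R (suc-injective (trans (sym (↭-length z↭)) (cong suc (length-toList t)))) =
  max a (toList t) , x , z↭ ,
  ListAll.tail (All-resp-↭ z↭ (⊥≤max a (toList t) ∷ xs≤max a (toList t)))

PAinv-drop-max : {y : Vec ℕ n} {z : Vec ℕ (suc n)} → All (0 <_) y → 0 < ℓ → PAinv (y ∷ʳ ℓ) z →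
                 ∃₂ λ b x → toList z ↭ b ∷ toList x × PAinv y x
PAinv-drop-max {ℓ = ℓ} {y = y} {z = z} 0<y 0<ℓ inv with b , x , z↭ , x≤b ← ∃-max z =
  b , x , z↭ , Inv⇒PAinv spots parks
  where
  parks : Inv (sum y) [] y (toList x)
  parks u u↭
    with _ , _ , _ , _ , earlier ← AllPark-∷ʳ⁻ {b = b} 0<ℓ
           (subst (λ m → AllPark m [] (y ∷ʳ ℓ) (u ∷ʳ b)) (sum-∷ʳ y ℓ)
             (PAinv⇒Inv inv (u ∷ʳ b)
               (↭-trans (toList-∷ʳ-↭ u b) (↭-trans (prep b u↭) (↭-sym z↭)))))
           (toList⁻ (All-resp-↭ (↭-sym u↭) x≤b)) = earlier []
  spots : ListAll.All (Spot (sum y)) (toList x)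
  spots = ListAll.zip
    ( ListAll.map proj₁ (ListAll.tail (All-resp-↭ z↭ (PAinv-spots inv)))
    , toList⁺ (AllPark-preferences≤ 0<y (parks x ↭-refl)) )

-- Degrees and the characteristic

-- Obtained by appending one car at a time, this assortment shows that the default 0 in `χ` is an
-- attained degree.
PAinv-replicate : (y : Vec ℕ n) → All (0 <_) y → PAinv y (replicate n 1)
PAinv-replicate {zero}  [] _ = Inv⇒PAinv [] λ { [] _ → [] }
PAinv-replicate {suc n} y 0<y with y′ , ℓ , refl ← initLast y
  with 0<ℓ ∷ 0<y′ ← All-resp-↭ (toList-∷ʳ-↭ y′ ℓ) (toList⁺ 0<y) =
  PAinv-1∷ (toList⁻ 0<y′) 0<ℓ (PAinv-replicate y′ (toList⁻ 0<y′))

deg≤χ : {y x : Vec ℕ n} → PAinv y x → deg x ≤ χ y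
deg≤χ {y = y} inv@((spots , _) , _) =
  ListAll.lookup (xs≤max 0 _) (∈-map⁺ deg (∈-filter⁺ (paInv? y) (∈-preferences spots) inv))

χ-attained : (y : Vec ℕ n) → All (0 <_) y → ∃ λ x → PAinv y x × deg x ≡ χ y
χ-attained {n} y 0<y =
  argmax-all (λ k → k) {P = λ k → ∃ λ x → PAinv y x × deg x ≡ k}
    (replicate n 1 , PAinv-replicate y 0<y , deg-replicate n)
    (ListAll.map⁺ (ListAll.tabulate λ {x} x∈ → x , proj₂ (∈-filter⁻ (paInv? y) {xs = preferences (sum y) n} x∈) , refl))
  where
  deg-replicate : ∀ n → deg (replicate n 1) ≡ 0
  deg-replicate zero    = refl
  deg-replicate (suc n) = deg-replicate n

-- The degree on lists, where invariance under permutation follows from that of `filter`.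
degᴸ : List ℕ → ℕ
degᴸ xs = length (filter (λ s → ¬? (s ≟ 1)) xs)

deg-toList : (x : Vec ℕ n) → deg x ≡ degᴸ (toList x)
deg-toList []       = refl
deg-toList (s ∷ x) with does (¬? (s ≟ 1))
... | false = deg-toList x
... | true  = cong suc (deg-toList x)

deg-↭ : {x : Vec ℕ n} → toList x ↭ xs → deg x ≡ degᴸ xs
deg-↭ {x = x} x↭ = trans (deg-toList x) (↭-length (filter-↭ (λ s → ¬? (s ≟ 1)) x↭))

PAinv-deg-pred : {y x : Vec ℕ n} {d : ℕ} → All (0 <_) y → PAinv y x → deg x ≡ suc d →
                 ∃ λ x′ → PAinv y x′ × deg x′ ≡ d
PAinv-deg-pred {x = x} 0<y inv deg≡
  with filter (λ s → ¬? (s ≟ 1)) (toList x) in eq | trans (sym deg≡) (deg-toList x)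
-- An empty filter is excluded by the positive degree; `v` is the first entry other than 1, and it
-- is lowered to 1.
... | v ∷ _ | _
  with v∈ , v≢1 ← ∈-filter⁻ (λ s → ¬? (s ≟ 1)) (subst (v ∈_) (sym eq) (here refl))
  with T , x↭ ← ∈⇒↭ v∈
  with x′ , x′≡ ← vecOf (1 ∷ T) (trans (sym (↭-length x↭)) (length-toList x)) =
  x′ , PAinv-lower 0<y inv x↭ (↭-reflexive x′≡) ,
  trans (deg-↭ {x = x′} (↭-reflexive x′≡))
    (suc-injective (trans (cong length (sym (filter-accept (λ s → ¬? (s ≟ 1)) v≢1)))
      (trans (sym (deg-↭ {x = x} x↭)) deg≡)))

PAinv-deg-≤ : {y : Vec ℕ n} → All (0 <_) y → ∀ o {d} → (∃ λ x → PAinv y x × deg x ≡ o + d) →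
              ∃ λ x → PAinv y x × deg x ≡ d
PAinv-deg-≤ 0<y zero    found = found
PAinv-deg-≤ 0<y (suc o) (x , inv , deg≡) = PAinv-deg-≤ 0<y o (PAinv-deg-pred 0<y inv deg≡)

-- Spot 1 ends up occupied, which takes a preference of at most 1.
1∈PAinv : {y x : Vec ℕ (suc n)} → PAinv y x → 1 ∈ toList x
1∈PAinv {x = x@(_ ∷ _)} inv@((spots@((1≤s , s≤m) ∷ _) , parks) , _)
  with s , s∈ , s≤1 ← find (covering-preference parks empty (All.map proj₁ spots) (≤-refl , ≤-trans 1≤s s≤m) λ ()) =
  subst (_∈ toList x) (≤-antisym s≤1 (proj₁ (ListAll.lookup (PAinv-spots inv) s∈))) s∈

deg<n : {y x : Vec ℕ n} .{{_ : NonZero n}} → PAinv y x → deg x < n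
deg<n {n = suc n} {x = x} inv with T , x↭ ← ∈⇒↭ (1∈PAinv inv) =
  subst (_< suc n) (sym (deg-↭ {x = x} x↭))
    (s≤s (≤-trans (length-filter (λ s → ¬? (s ≟ 1)) T)
      (≤-reflexive (suc-injective (trans (sym (↭-length x↭)) (length-toList x))))))

χ-∷ʳ-≥ : {y : Vec ℕ n} → All (0 <_) y → 0 < ℓ → χ y ≤ χ (y ∷ʳ ℓ)
χ-∷ʳ-≥ {y = y} 0<y 0<ℓ with x , inv , deg≡ ← χ-attained y 0<y =
  ≤-trans (≤-reflexive (sym deg≡)) (deg≤χ (PAinv-1∷ 0<y 0<ℓ inv))

-- Deleting the greatest entry of a maximizer for the longer street lowers its degree by at most
-- one.
χ-∷ʳ-≤ : {y : Vec ℕ n} → All (0 <_) y → 0 < ℓ → χ (y ∷ʳ ℓ) ≤ suc (χ y)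
χ-∷ʳ-≤ {ℓ = ℓ} {y = y} 0<y 0<ℓ
  with z , inv , deg≡ ← χ-attained (y ∷ʳ ℓ) (toList⁻ (All-resp-↭ (↭-sym (toList-∷ʳ-↭ y ℓ)) (0<ℓ ∷ toList⁺ 0<y)))
  with b , x , z↭ , inv′ ← PAinv-drop-max 0<y 0<ℓ inv = begin
  χ (y ∷ʳ ℓ)          ≡⟨ trans (sym deg≡) (deg-↭ {x = z} z↭) ⟩
  degᴸ (b ∷ toList x) ≡⟨ deg-toList (b ∷ x) ⟨
  deg (b ∷ x)         ≤⟨ deg-∷-≤ ⟩
  suc (deg x)         ≤⟨ s≤s (deg≤χ inv′) ⟩
  suc (χ y)           ∎
  where
  open ≤-Reasoning
  deg-∷-≤ : deg (b ∷ x) ≤ suc (deg x)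
  deg-∷-≤ with does (¬? (b ≟ 1))
  ... | false = n≤1+n _
  ... | true  = ≤-refl

-- Nondecreasing and padded vectors, and the four claims

Linked-1∷ : {x : Vec ℕ n} → All (1 ≤_) x → Linked _≤_ x → Linked _≤_ (1 ∷ x)
Linked-1∷ []        []     = [-]
Linked-1∷ (1≤s ∷ _) linked = 1≤s ∷ linked

removeAt-↭ : (w : Vec ℕ (suc n)) (i : Fin (suc n)) → toList w ↭ lookup w i ∷ toList (removeAt w i)
removeAt-↭ (v ∷ w)     zero    = ↭-refl
removeAt-↭ (v ∷ u ∷ w) (suc i) = ↭-trans (prep v (removeAt-↭ (u ∷ w) i)) (swap v _ ↭-refl)

toList-pad : ∀ {d} (d≤n : d ≤ n) (w : Vec ℕ d) →
             toList (pad d≤n w) ≡ toList (replicate (n ∸ d) 1) List.++ toList w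
toList-pad {n} {d} d≤n w =
  trans (toList-cast _ (replicate (n ∸ d) 1 Vec.++ w)) (toList-++ (replicate (n ∸ d) 1) w)

PAinv-removeAt : ∀ {d} {y : Vec ℕ n} → All (0 <_) y → (d<n : suc d ≤ n) (w : Vec ℕ (suc d)) →
                 PAinv y (pad d<n w) → ∀ i → PAinv y (pad (<⇒≤ d<n) (removeAt w i))
PAinv-removeAt {n} {d} 0<y d<n w inv i = PAinv-lower 0<y inv
  (↭-trans (↭-reflexive (toList-pad d<n w))
    (↭-trans (++⁺ˡ ones (removeAt-↭ w i)) (shift (lookup w i) ones _)))
  -- `n ∸ d` is by definition `suc n ∸ suc d`, which equals `suc (n ∸ suc d)` as `suc d ≤ n`: this
  -- is the additional leading 1.
  (↭-reflexive (trans (toList-pad (<⇒≤ d<n) (removeAt w i))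
    (cong (λ k → toList (replicate k 1) List.++ toList (removeAt w i)) (+-∸-assoc 1 d<n))))
  where
  ones : List ℕ
  ones = toList (replicate (n ∸ suc d) 1)

theorem4 : ∀ (n : ℕ) .{{_ : NonZero n}} (y : Vec ℕ n) (yₙ₊₁ : ℕ) → All (0 <_) y → 0 < yₙ₊₁ →
    let y⁺ = y ∷ʳ yₙ₊₁ in
    -- (a): an index i ∈ [d] exists only for positive d, here written suc d
    (∀ {d} (d<n : suc d ≤ n) (w : Vec ℕ (suc d)) → All (1 <_) w →
       PAinv y (pad d<n w) →
       ∀ (i : Fin (suc d)) → PAinv y (pad (<⇒≤ d<n) (removeAt w i)))
    -- (b)
    × ((∀ (x : Vec ℕ n) → PAinv y x → deg x < n)
       × (∀ (d : ℕ) → (∃ λ (x : Vec ℕ n) → PAinv y x × deg x ≡ d) ⇔ d ≤ χ y))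
    -- (c)
    × ((∀ (x : Vec ℕ n) → PAinv y x → PAinv y⁺ (1 ∷ x))
       × (Σ[ η ∈ Injection (PAinv↑-setoid y) (PAinv↑-setoid y⁺) ]
            (∀ (x : ∃ (PAinv↑ y)) → proj₁ (Injection.to η x) ≡ 1 ∷ proj₁ x)))
    -- (d)
    × (∀ (α : ℕ) → χ y ≡ α → χ y⁺ ≡ α ⊎ χ y⁺ ≡ suc α)
theorem4 n y yₙ₊₁ 0<y 0<yₙ₊₁ =
  (λ d<n w _ → PAinv-removeAt 0<y d<n w)
  , ((λ _ → deg<n) , λ d → mk⇔ (λ { (x , inv , refl) → deg≤χ inv }) degree-attained)
  , ((λ _ → PAinv-1∷ 0<y 0<yₙ₊₁) , η , λ _ → refl)
  , λ { _ refl → χ-dichotomy }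
  where
  degree-attained : ∀ {d} → d ≤ χ y → ∃ λ x → PAinv y x × deg x ≡ d
  degree-attained {d} d≤χ with x , inv , deg≡ ← χ-attained y 0<y =
    PAinv-deg-≤ 0<y (χ y ∸ d) (x , inv , trans deg≡ (sym (m∸n+n≡m d≤χ)))
  η : Injection (PAinv↑-setoid y) (PAinv↑-setoid (y ∷ʳ yₙ₊₁))
  η = record
    { to        = λ (x , inv@((spots , _) , _) , linked) →
        1 ∷ x , PAinv-1∷ 0<y 0<yₙ₊₁ inv , Linked-1∷ (All.map proj₁ spots) linked
    ; cong      = cong (1 ∷_)
    ; injective = ∷-injectiveʳ
    }
  χ-dichotomy : χ (y ∷ʳ yₙ₊₁) ≡ χ y ⊎ χ (y ∷ʳ yₙ₊₁) ≡ suc (χ y)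
  χ-dichotomy with m≤n⇒m<n∨m≡n (χ-∷ʳ-≥ 0<y 0<yₙ₊₁)
  ... | inj₁ χ<χ⁺ = inj₂ (≤-antisym (χ-∷ʳ-≤ 0<y 0<yₙ₊₁) χ<χ⁺)
  ... | inj₂ χ≡χ⁺ = inj₁ (sym χ≡χ⁺)
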